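{- Let $\mathcal{R}$ be a partial selection rule which never selects a $sat\_cl5$-atom whose first and third arguments are both variables, and which selects some atom in each query containing at least one atom not of this form. Let $Q_0=sat(u,l)$, where $u$ is a representation of a propositional formula in CNF and $l$ is the list of the variables in $u$. Then no SLD-derivation of $P_3$ for $Q_0$ via $\mathcal{R}$ flounders.
   Context: Prolog list notation is used ($[\,]$ is a constant, $[h|t]$ a binary constructor); $-$ is a binary function symbol written infix; $\mathtt{true},\mathtt{false}$ are constants. Representation of CNF formulae: propositional variables are represented as logical variables; a positive literal $x$ is represented as the term $\mathtt{true}-X$, a negative literal $\neg x$ as $\mathtt{false}-X$; a clause is represented as the list of the representations of its literals, and a conjunction of clauses as the list of the representations of the clauses. A partial selection rule is a selection rule for SLD-resolution that may be a partial function: in some non-empty queries no atom may be selected. A non-empty query in which no atom is selected is called floundered; a derivation flounders if a floundered query occurs in it. A $p$-atom is an atom with predicate symbol $p$. The definite clause program $P_3$ consists of the following rules (names beginning with upper-case letters are variables): 1. $sat\_cnf([\,])$. 2. $sat\_cnf([C|Cs])\gets sat\_cl(C), sat\_cnf(Cs)$. 3. $sat\_cl([P-V|R])\gets sat\_cl3(R,V,P)$. 4. ${=}(X,X)$. 5. $sat\_cl3([\,],V,P)\gets V=P$. 6. $sat\_cl3([P_2-V_2|R],V_1,P_1)\gets sat\_cl5(V_1,P_1,V_2,P_2,R)$. 7. $sat\_cl5(V_1,P_1,V_2,P_2,R)\gets sat\_cl5a(V_1,P_1,V_2,P_2,R)$. 8. $sat\_cl5(V_1,P_1,V_2,P_2,R)\gets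 sat\_cl5a(V_2,P_2,V_1,P_1,R)$. 9. $sat\_cl5a(V_1,P_1,V_2,P_2,R)\gets V_1=P_1$. 10. $sat\_cl5a(V_1,P_1,V_2,P_2,R)\gets sat\_cl3(R,V_2,P_2)$. 11. $sat(Cs,Vs)\gets sat\_cnf(Cs), tflist(Vs)$. 12. $tflist([\,])$. 13. $tflist([V|Vs])\gets tflist(Vs), tf(V)$. 14. $tf(\mathtt{true})$. 15. $tf(\mathtt{false})$. -}

module Defs where

open import Data.Fin using (Fin; toℕ)
open import Data.List using (List; []; _∷_; _++_; [_]; map; length; lookup; take; drop)
open import Data.List.Membership.Propositional using (_∈_; _∉_)
open import Data.List.Relation.Unary.Any using (Any)
open import Data.Maybe using (Maybe; just; nothing)
open import Data.Nat using (ℕ; suc)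
open import Data.Product using (Σ; ∃; ∃-syntax; _×_; _,_)
open import Data.Sum using (_⊎_)
open import Data.Unit using (⊤)
open import Data.Vec using (Vec; []; _∷_)
open import Function using (_⇔_; Injective)
open import Relation.Binary.Construct.Closure.ReflexiveTransitive using (Star)
open import Relation.Binary.PropositionalEquality using (_≡_; _≢_)
open import Relation.Nullary using (¬_)

------------------------------------------------------------------------
-- Terms, atoms, substitutions

Var : Set
Var = ℕ

-- The alphabet has, besides the function symbols of the program, countably
-- many further ones of each arity: `other n k` is the k-th of arity n.
data Fun : Set where
  nil cons minus tt ff : Fun
  other : (n k : ℕ) → Fun

arity : Fun → ℕ
arity nil         = 0
arity cons        = 2
arity minus       = 2
arity tt          = 0
arity ff          = 0
arity (other n _) = n

data Term : Set where
  var : Var → Term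
  fn  : (f : Fun) → Vec Term (arity f) → Term

data Pred : Set where
  sat sat-cnf sat-cl sat-cl3 sat-cl5 sat-cl5a equals tflist tf : Pred

predArity : Pred → ℕ
predArity sat      = 2
predArity sat-cnf  = 1
predArity sat-cl   = 1
predArity sat-cl3  = 3
predArity sat-cl5  = 5
predArity sat-cl5a = 5
predArity equals   = 2
predArity tflist   = 1
predArity tf       = 1

data Atom : Set where
  atom : (p : Pred) → Vec Term (predArity p) → Atom

Query : Set
Query = List Atom

infix 4 _⇐_
record Clause : Set where
  constructor _⇐_
  field
    head : Atom
    body : Query
open Clause public

Program : Set
Program = List Clause

mutual
  vars : Term → List Var
  vars (var x)   = [ x ]
  vars (fn f ts) = varsVec ts

  varsVec : ∀ {n} → Vec Term n → List Var
  varsVec []       = []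
  varsVec (t ∷ ts) = vars t ++ varsVec ts

varsAtom : Atom → List Var
varsAtom (atom p ts) = varsVec ts

varsQuery : Query → List Var
varsQuery []      = []
varsQuery (A ∷ Q) = varsAtom A ++ varsQuery Q

varsClause : Clause → List Var
varsClause (H ⇐ B) = varsAtom H ++ varsQuery B

record Subst : Set where
  field
    apply   : Var → Term
    support : List Var
    fixed   : ∀ {x} → x ∉ support → apply x ≡ var x
open Subst public

infixl 8 _[_]ᵗ _[_]ᵛ _[_]ᵃ _[_]q _[_]ᶜ

mutual
  _[_]ᵗ : Term → Subst → Term
  var x   [ θ ]ᵗ = apply θ x
  fn f ts [ θ ]ᵗ = fn f (ts [ θ ]ᵛ)

  _[_]ᵛ : ∀ {n} → Vec Term n → Subst → Vec Term n
  []       [ θ ]ᵛ = []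
  (t ∷ ts) [ θ ]ᵛ = t [ θ ]ᵗ ∷ ts [ θ ]ᵛ

_[_]ᵃ : Atom → Subst → Atom
atom p ts [ θ ]ᵃ = atom p (ts [ θ ]ᵛ)

_[_]q : Query → Subst → Query
Q [ θ ]q = map (_[ θ ]ᵃ) Q

_[_]ᶜ : Clause → Subst → Clause
(H ⇐ B) [ θ ]ᶜ = H [ θ ]ᵃ ⇐ B [ θ ]q

-- x ∈ Var(θ) : x is in the domain of θ, or occurs in the image of a variable
-- from the domain (`support` may be larger than the domain).
_∈Subst_ : Var → Subst → Set
x ∈Subst θ = apply θ x ≢ var x
           ⊎ ∃[ y ] (apply θ y ≢ var y × x ∈ vars (apply θ y))

Unifier : Atom → Atom → Subst → Set
Unifier A B θ = A [ θ ]ᵃ ≡ B [ θ ]ᵃ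

MoreGeneral : Subst → Subst → Set
MoreGeneral θ σ = ∃[ η ] (∀ x → apply σ x ≡ apply θ x [ η ]ᵗ)

MGU : Atom → Atom → Subst → Set
MGU A B θ = Unifier A B θ × (∀ σ → Unifier A B σ → MoreGeneral θ σ)

Variant : Clause → Clause → Set
Variant c d = (∃[ σ ] d ≡ c [ σ ]ᶜ) × (∃[ τ ] c ≡ d [ τ ]ᶜ)

------------------------------------------------------------------------
-- SLD-derivations

replaceAt : (Q : Query) → Fin (length Q) → Query → Query
replaceAt Q i B = take (toℕ i) Q ++ B ++ drop (suc (toℕ i)) Q

module SLD (P : Program) where

  -- `Fragment Q₀ Q` : finite sequences of SLD-resolution steps from Q₀ to Q.
  -- `Used D` : the variables of the initial query and of all input clauses and
  -- mgus of D; the next input clause must be standardized apart from them.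
  mutual
    data Fragment (Q₀ : Query) : Query → Set where
      start : Fragment Q₀ Q₀
      _▷_   : ∀ {Q} (D : Fragment Q₀ Q) (s : Step D) → Fragment Q₀ (resolvent s)

    record Step {Q₀ Q : Query} (D : Fragment Q₀ Q) : Set where
      inductive
      field
        selected : Fin (length Q)
        rule     : Clause
        rule∈P   : rule ∈ P
        input    : Clause
        variant  : Variant rule input
        apart    : ∀ {x} → x ∈ varsClause input → ¬ Used D x
        mgu      : Subst
        isMGU    : MGU (lookup Q selected) (head input) mgu

    resolvent : ∀ {Q₀ Q} {D : Fragment Q₀ Q} → Step D → Query
    resolvent {Q = Q} s =
      replaceAt Q (Step.selected s) (body (Step.input s)) [ Step.mgu s ]q

    Used : ∀ {Q₀ Q} → Fragment Q₀ Q → Var → Set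
    Used {Q₀} start   x = x ∈ varsQuery Q₀
    Used      (D ▷ s) x =
      Used D x ⊎ x ∈ varsClause (Step.input s) ⊎ x ∈Subst Step.mgu s

  infixl 5 _▷_

  data _↝_ {Q₀ : Query} : (D E : ∃ (Fragment Q₀)) → Set where
    extend : ∀ {Q} {D : Fragment Q₀ Q} (s : Step D) → (Q , D) ↝ (resolvent s , D ▷ s)

  record InfiniteDerivation (Q₀ : Query) : Set where
    field
      prefix  : ℕ → ∃ (Fragment Q₀)
      starts  : prefix 0 ≡ (Q₀ , start)
      extends : ∀ n → prefix n ↝ prefix (suc n)
  open InfiniteDerivation public

  -- Finite derivations are not required to be maximal.
  data Derivation (Q₀ : Query) : Set where
    finite   : ∀ {Q} → Fragment Q₀ Q → Derivation Q₀
    infinite : InfiniteDerivation Q₀ → Derivation Q₀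

  data _PrefixOf_ {Q₀ Q : Query} (E : Fragment Q₀ Q) : Derivation Q₀ → Set where
    finite   : ∀ {Q′} {D : Fragment Q₀ Q′} →
               Star _↝_ (Q , E) (Q′ , D) → E PrefixOf finite D
    infinite : ∀ {D : InfiniteDerivation Q₀} (n : ℕ) →
               prefix D n ≡ (Q , E) → E PrefixOf infinite D

  -- The selection may depend on the whole history of the query.
  PartialSelectionRule : Set
  PartialSelectionRule = ∀ {Q₀ Q} → Fragment Q₀ Q → Maybe (Fin (length Q))

  module _ (ℛ : PartialSelectionRule) where

    FragmentVia : ∀ {Q₀ Q} → Fragment Q₀ Q → Set
    FragmentVia start   = ⊤
    FragmentVia (D ▷ s) = FragmentVia D × ℛ D ≡ just (Step.selected s)

    Via : ∀ {Q₀} → Derivation Q₀ → Set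
    Via 𝒟 = ∀ {Q} (E : Fragment _ Q) → E PrefixOf 𝒟 → FragmentVia E

    Floundered : ∀ {Q₀ Q} → Fragment Q₀ Q → Set
    Floundered {Q = Q} E = Q ≢ [] × ℛ E ≡ nothing

    Flounders : ∀ {Q₀} → Derivation Q₀ → Set
    Flounders {Q₀} 𝒟 =
      ∃[ Q ] Σ (Fragment Q₀ Q) λ E → E PrefixOf 𝒟 × Floundered E

    NeverSelects : (Atom → Set) → Set
    NeverSelects F = ∀ {Q₀ Q} (D : Fragment Q₀ Q) i → ℛ D ≡ just i → ¬ F (lookup Q i)

    SelectsIfAnyNot : (Atom → Set) → Set
    SelectsIfAnyNot F = ∀ {Q₀ Q} (D : Fragment Q₀ Q) →
      Any (λ A → ¬ F A) Q → ∃[ i ] ℛ D ≡ just i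

------------------------------------------------------------------------
-- The program P₃

pattern ⟨⟩      = fn nil []
pattern _∣_ h t = fn cons (h ∷ t ∷ [])
pattern _─_ s t = fn minus (s ∷ t ∷ [])
pattern 𝐭       = fn tt []
pattern 𝐟       = fn ff []

infixr 5 _∣_
infix  6 _─_

pattern sat⟨_,_⟩           s t       = atom sat (s ∷ t ∷ [])
pattern sat-cnf⟨_⟩         t         = atom sat-cnf (t ∷ [])
pattern sat-cl⟨_⟩          t         = atom sat-cl (t ∷ [])
pattern sat-cl3⟨_,_,_⟩     r v p     = atom sat-cl3 (r ∷ v ∷ p ∷ [])
pattern sat-cl5⟨_,_,_,_,_⟩ v p w q r = atom sat-cl5 (v ∷ p ∷ w ∷ q ∷ r ∷ [])
pattern sat-cl5a⟨_,_,_,_,_⟩ v p w q r = atom sat-cl5a (v ∷ p ∷ w ∷ q ∷ r ∷ [])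
pattern _≐_                s t       = atom equals (s ∷ t ∷ [])
pattern tflist⟨_⟩          t         = atom tflist (t ∷ [])
pattern tf⟨_⟩              t         = atom tf (t ∷ [])

infix 4 _≐_

P₃ : Program
P₃ =
    (sat-cnf⟨ ⟨⟩ ⟩                  ⇐ [])
  ∷ (sat-cnf⟨ C ∣ Cs ⟩              ⇐ sat-cl⟨ C ⟩ ∷ sat-cnf⟨ Cs ⟩ ∷ [])
  ∷ (sat-cl⟨ P ─ V ∣ R ⟩            ⇐ sat-cl3⟨ R , V , P ⟩ ∷ [])
  ∷ ((X ≐ X)                        ⇐ [])
  ∷ (sat-cl3⟨ ⟨⟩ , V , P ⟩          ⇐ (V ≐ P) ∷ [])
  ∷ (sat-cl3⟨ P₂ ─ V₂ ∣ R , V₁ , P₁ ⟩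
                                    ⇐ sat-cl5⟨ V₁ , P₁ , V₂ , P₂ , R ⟩ ∷ [])
  ∷ (sat-cl5⟨ V₁ , P₁ , V₂ , P₂ , R ⟩
                                    ⇐ sat-cl5a⟨ V₁ , P₁ , V₂ , P₂ , R ⟩ ∷ [])
  ∷ (sat-cl5⟨ V₁ , P₁ , V₂ , P₂ , R ⟩
                                    ⇐ sat-cl5a⟨ V₂ , P₂ , V₁ , P₁ , R ⟩ ∷ [])
  ∷ (sat-cl5a⟨ V₁ , P₁ , V₂ , P₂ , R ⟩
                                    ⇐ (V₁ ≐ P₁) ∷ [])
  ∷ (sat-cl5a⟨ V₁ , P₁ , V₂ , P₂ , R ⟩
                                    ⇐ sat-cl3⟨ R , V₂ , P₂ ⟩ ∷ [])
  ∷ (sat⟨ Cs , Vs ⟩                 ⇐ sat-cnf⟨ Cs ⟩ ∷ tflist⟨ Vs ⟩ ∷ [])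
  ∷ (tflist⟨ ⟨⟩ ⟩                   ⇐ [])
  ∷ (tflist⟨ V ∣ Vs ⟩               ⇐ tflist⟨ Vs ⟩ ∷ tf⟨ V ⟩ ∷ [])
  ∷ (tf⟨ 𝐭 ⟩                        ⇐ [])
  ∷ (tf⟨ 𝐟 ⟩                        ⇐ [])
  ∷ []
  where
  C Cs P V R X P₁ V₁ P₂ V₂ Vs : Term
  C  = var 0
  Cs = var 1
  P  = var 2
  V  = var 3
  R  = var 4
  X  = var 5
  P₁ = var 6
  V₁ = var 7
  P₂ = var 8
  V₂ = var 9
  Vs = var 10

data DelayedAtom : Atom → Set where
  delayed : ∀ {x y p q r} → DelayedAtom sat-cl5⟨ var x , p , var y , q , r ⟩

------------------------------------------------------------------------
-- Propositional formulae in CNF and their representation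

PropVar : Set
PropVar = ℕ

data Literal : Set where
  pos neg : PropVar → Literal

CNF : Set
CNF = List (List Literal)

listTerm : List Term → Term
listTerm []       = ⟨⟩
listTerm (t ∷ ts) = t ∣ listTerm ts

module _ (ρ : PropVar → Var) where

  reprLiteral : Literal → Term
  reprLiteral (pos x) = 𝐭 ─ var (ρ x)
  reprLiteral (neg x) = 𝐟 ─ var (ρ x)

  reprClause : List Literal → Term
  reprClause c = listTerm (map reprLiteral c)

  reprCNF : CNF → Term
  reprCNF φ = listTerm (map reprClause φ)

-- Distinct propositional variables are represented by distinct logical ones.
Represents : Term → CNF → Set
Represents u φ = ∃[ ρ ] (Injective _≡_ _≡_ ρ × u ≡ reprCNF ρ φ)

-- The order of the variables, and possible repetitions, are left open.
ListOfVarsOf : Term → Term → Set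
ListOfVarsOf l u =
  ∃[ xs ] (l ≡ listTerm (map var xs) × (∀ x → x ∈ xs ⇔ x ∈ vars u))

{-# OPTIONS --safe #-}
-- Call a term covered by a query if it is not a variable, or if it is an
-- argument of a tf-atom, an element of the list of a tflist-atom, or an element
-- of the second argument of a sat-atom.  In every query of a derivation from
-- Q₀, all terms standing at the place of a propositional variable in the
-- sat…-atoms are covered: instantiation preserves this, and an element that
-- leaves the tf- and tflist-atoms has been bound to true or false.  The first
-- argument of a delayed atom is thus listed in another atom, and atoms that
-- list something are not delayed.
module Submission where

open import Defs
open import Data.Fin using (Fin; zero; suc)
open import Data.List using ([]; _∷_; map; length; lookup)
open import Data.List.Membership.Propositional using (_∈_)
open import Data.List.Membership.Propositional.Properties using (∈-++⁺ˡ; ∈-++⁺ʳ; ∈-lookup)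
open import Data.List.Relation.Unary.All as All using (All; []; _∷_)
import Data.List.Relation.Unary.All.Properties as All
open import Data.List.Relation.Unary.Any as Any using (Any; here; there)
import Data.List.Relation.Unary.Any.Properties as Any
open import Data.Product using (_,_)
open import Data.Sum using (_⊎_; inj₁; inj₂)
open import Function using (_∘_; Equivalence)
open import Relation.Binary.PropositionalEquality using (_≢_; refl; sym; trans; subst)
open import Relation.Nullary using (¬_; Dec; yes; no; contradiction)
open import Relation.Unary using (_⊆_)
open SLD P₃

data NonVar : Term → Set where
  fn : ∀ {f ts} → NonVar (fn f ts)

infix 4 _∈ᵗ_

-- Only the cons cells leading to `v` are required; the rest may be any term, so membership is
-- stable under substitution.
data _∈ᵗ_ (v : Term) : Term → Set where
  here  : ∀ {t} → v ∈ᵗ (v ∣ t)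
  there : ∀ {s t} → v ∈ᵗ t → v ∈ᵗ (s ∣ t)

data Lists (v : Term) : Atom → Set where
  sat    : ∀ {u l} → v ∈ᵗ l → Lists v sat⟨ u , l ⟩
  tflist : ∀ {l} → v ∈ᵗ l → Lists v tflist⟨ l ⟩
  tf     : Lists v tf⟨ v ⟩

data Covered (Q : Query) (v : Term) : Set where
  nonVar : NonVar v → Covered Q v
  listed : Any (Lists v) Q → Covered Q v

data ListOver (P : Term → Set) : Term → Set where
  []  : ListOver P ⟨⟩
  _∷_ : ∀ {s t} → P s → ListOver P t → ListOver P (s ∣ t)

-- The polarity is unconstrained because delaying depends only on the terms in variable position.
data LiteralOver (K : Term → Set) : Term → Set where
  lit : ∀ {p v} → K v → LiteralOver K (p ─ v)

ClauseOver CNFOver : (Term → Set) → Term → Set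
ClauseOver K = ListOver (LiteralOver K)
CNFOver K    = ListOver (ClauseOver K)

-- `K` is kept abstract so that the program clauses can be checked once for all `K`. Nothing is
-- demanded of `equals`, `tflist` and `tf`: their clauses never call the predicates that traverse
-- the formula.
data AtomOver (K : Term → Set) : Atom → Set where
  sat     : ∀ {u l} → CNFOver K u → AtomOver K sat⟨ u , l ⟩
  sat-cnf : ∀ {u} → CNFOver K u → AtomOver K sat-cnf⟨ u ⟩
  sat-cl  : ∀ {c} → ClauseOver K c → AtomOver K sat-cl⟨ c ⟩
  sat-cl3 : ∀ {r v p} → ClauseOver K r → K v → AtomOver K sat-cl3⟨ r , v , p ⟩
  sat-cl5 : ∀ {v p w q r} → K v → K w → ClauseOver K r →
            AtomOver K sat-cl5⟨ v , p , w , q , r ⟩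
  sat-cl5a : ∀ {v p w q r} → K v → K w → ClauseOver K r →
             AtomOver K sat-cl5a⟨ v , p , w , q , r ⟩
  equals  : ∀ {s t} → AtomOver K (s ≐ t)
  tflist  : ∀ {l} → AtomOver K tflist⟨ l ⟩
  tf      : ∀ {t} → AtomOver K tf⟨ t ⟩

SafeQuery : Query → Set
SafeQuery Q = All (AtomOver (Covered Q)) Q

∈ᵗ-subst : ∀ {v t} θ → v ∈ᵗ t → v [ θ ]ᵗ ∈ᵗ t [ θ ]ᵗ
∈ᵗ-subst θ here      = here
∈ᵗ-subst θ (there m) = there (∈ᵗ-subst θ m)

Lists-subst : ∀ {v A} θ → Lists v A → Lists (v [ θ ]ᵗ) (A [ θ ]ᵃ)
Lists-subst θ (sat m)    = sat (∈ᵗ-subst θ m)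
Lists-subst θ (tflist m) = tflist (∈ᵗ-subst θ m)
Lists-subst θ tf         = tf

ListOver-subst : ∀ {P P′ : Term → Set} θ → P ⊆ P′ ∘ _[ θ ]ᵗ →
                 ListOver P ⊆ ListOver P′ ∘ _[ θ ]ᵗ
ListOver-subst θ f []       = []
ListOver-subst θ f (p ∷ ps) = f p ∷ ListOver-subst θ f ps

LiteralOver-subst : ∀ {K K′ : Term → Set} θ → K ⊆ K′ ∘ _[ θ ]ᵗ →
                    LiteralOver K ⊆ LiteralOver K′ ∘ _[ θ ]ᵗ
LiteralOver-subst θ f (lit k) = lit (f k)

AtomOver-subst : ∀ {K K′ : Term → Set} θ → K ⊆ K′ ∘ _[ θ ]ᵗ →
                 AtomOver K ⊆ AtomOver K′ ∘ _[ θ ]ᵃ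
AtomOver-subst {K} {K′} θ f = atom′
  where
  clause : ClauseOver K ⊆ ClauseOver K′ ∘ _[ θ ]ᵗ
  clause = ListOver-subst θ (LiteralOver-subst θ f)

  cnf : CNFOver K ⊆ CNFOver K′ ∘ _[ θ ]ᵗ
  cnf = ListOver-subst θ clause

  atom′ : AtomOver K ⊆ AtomOver K′ ∘ _[ θ ]ᵃ
  atom′ (sat u)          = sat (cnf u)
  atom′ (sat-cnf u)      = sat-cnf (cnf u)
  atom′ (sat-cl c)       = sat-cl (clause c)
  atom′ (sat-cl3 r v)    = sat-cl3 (clause r) (f v)
  atom′ (sat-cl5 v w r)  = sat-cl5 (f v) (f w) (clause r)
  atom′ (sat-cl5a v w r) = sat-cl5a (f v) (f w) (clause r)
  atom′ equals           = equals
  atom′ tflist           = tflist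
  atom′ tf               = tf

-- The two demands on a resolution step: terms listed by the vanishing atom stay covered, and the
-- new atoms inherit its shape. This is for instantiated clauses, since a bare head variable is not
-- yet a list of literals.
record Preserving (H : Atom) (B : Query) : Set₁ where
  field
    covers : ∀ {v} → Lists v H → Covered B v
    over   : ∀ {K} → AtomOver K H → All (AtomOver K) B

-- Two successive substitutions: the renaming of the program clause and the mgu.
instance-preserving : ∀ {c} σ θ → c ∈ P₃ →
  Preserving (head c [ σ ]ᵃ [ θ ]ᵃ) (body c [ σ ]q [ θ ]q)
instance-preserving σ θ (here refl) = record
  { covers = λ () ; over = λ { (sat-cnf []) → [] } }
instance-preserving σ θ (there (here refl)) = record
  { covers = λ ()
  ; over   = λ { (sat-cnf (c ∷ cs)) → sat-cl c ∷ sat-cnf cs ∷ [] } }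
instance-preserving σ θ (there (there (here refl))) = record
  { covers = λ ()
  ; over   = λ { (sat-cl (lit v ∷ r)) → sat-cl3 r v ∷ [] } }
instance-preserving σ θ (there (there (there (here refl)))) = record
  { covers = λ () ; over = λ { equals → [] } }
instance-preserving σ θ (there (there (there (there (here refl))))) = record
  { covers = λ () ; over = λ _ → equals ∷ [] }
instance-preserving σ θ (there (there (there (there (there (here refl)))))) = record
  { covers = λ ()
  ; over   = λ { (sat-cl3 (lit w ∷ r) v) → sat-cl5 v w r ∷ [] } }
instance-preserving σ θ
  (there (there (there (there (there (there (here refl))))))) = record
  { covers = λ ()
  ; over   = λ { (sat-cl5 v w r) → sat-cl5a v w r ∷ [] } }
instance-preserving σ θ
  (there (there (there (there (there (there (there (here refl)))))))) = record
  { covers = λ ()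
  -- The swap is harmless because both watched terms satisfy `K`.
  ; over   = λ { (sat-cl5 v w r) → sat-cl5a w v r ∷ [] } }
instance-preserving σ θ
  (there (there (there (there (there (there (there (there (here refl))))))))) = record
  { covers = λ () ; over = λ _ → equals ∷ [] }
instance-preserving σ θ
  (there (there (there (there (there (there (there (there (there (here refl)))))))))) = record
  { covers = λ ()
  ; over   = λ { (sat-cl5a v w r) → sat-cl3 r w ∷ [] } }
instance-preserving σ θ
  (there (there (there (there (there (there (there (there (there (there
    (here refl))))))))))) = record
  { covers = λ { (sat m) → listed (there (here (tflist m))) }
  ; over   = λ { (sat u) → sat-cnf u ∷ tflist ∷ [] } }
instance-preserving σ θ
  (there (there (there (there (there (there (there (there (there (there
    (there (here refl)))))))))))) = record
  { covers = λ { (tflist ()) } ; over = λ _ → [] }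
instance-preserving σ θ
  (there (there (there (there (there (there (there (there (there (there
    (there (there (here refl))))))))))))) = record
  { covers = λ { (tflist here)      → listed (there (here tf))
               ; (tflist (there m)) → listed (here (tflist m)) }
  -- The head of the list passes to the `tf`-atom, its tail to the `tflist`-atom.
  ; over   = λ _ → tflist ∷ tf ∷ [] }
instance-preserving σ θ
  (there (there (there (there (there (there (there (there (there (there
    (there (there (there (here refl)))))))))))))) = record
  -- Here alone, and in the next clause, a listed term is lost; by then it is a constant.
  { covers = λ { tf → nonVar fn } ; over = λ _ → [] }
instance-preserving σ θ
  (there (there (there (there (there (there (there (there (there (there
    (there (there (there (there (here refl))))))))))))))) = record
  { covers = λ { tf → nonVar fn } ; over = λ _ → [] }

module _ {P : Atom → Set} where

  All-replaceAt : ∀ {Q} i {B} → All P Q → All P B → All P (replaceAt Q i B)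
  All-replaceAt zero    (_ ∷ ps) bs = All.++⁺ bs ps
  All-replaceAt (suc i) (p ∷ ps) bs = p ∷ All-replaceAt i ps bs

  Any-replaceAt-new : ∀ Q i {B} → Any P B → Any P (replaceAt Q i B)
  Any-replaceAt-new (_ ∷ _) zero    b = Any.++⁺ˡ b
  Any-replaceAt-new (_ ∷ Q) (suc i) b = there (Any-replaceAt-new Q i b)

  Any-replaceAt-old : ∀ {Q} i {B} → Any P Q →
                      P (lookup Q i) ⊎ Any P (replaceAt Q i B)
  Any-replaceAt-old zero        (here p)  = inj₁ p
  Any-replaceAt-old zero    {B} (there a) = inj₂ (Any.++⁺ʳ B a)
  Any-replaceAt-old (suc i)     (here p)  = inj₂ (here p)
  Any-replaceAt-old (suc i)     (there a) with Any-replaceAt-old i a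
  ... | inj₁ p  = inj₁ p
  ... | inj₂ a′ = inj₂ (there a′)

module _ {Q : Query} (i : Fin (length Q)) {H : Atom} {B : Query} (θ : Subst)
         (pres : Preserving (H [ θ ]ᵃ) (B [ θ ]q)) (unif : Unifier (lookup Q i) H θ) where

  open Preserving pres

  Covered-resolvent : Covered Q ⊆ Covered (replaceAt Q i B [ θ ]q) ∘ _[ θ ]ᵗ
  Covered-resolvent (nonVar fn) = nonVar fn
  Covered-resolvent (listed a) with Any-replaceAt-old i a
  ... | inj₂ a′ = listed (Any.map⁺ (Any.map (Lists-subst θ) a′))
  -- The listing atom is the selected one, so after unification the clause head lists the term.
  ... | inj₁ m with covers (subst (Lists _) unif (Lists-subst θ m))
  ...   | nonVar n = nonVar n
  ...   | listed b = listed (Any.map⁺ (Any-replaceAt-new Q i (Any.map⁻ b)))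

  -- After applying `θ`, the old atoms are safe with respect to the coverage of the resolvent. The
  -- selected one then equals the instantiated head, so `over`, taken at that coverage, yields the
  -- body.
  SafeQuery-resolvent : SafeQuery Q → SafeQuery (replaceAt Q i B [ θ ]q)
  SafeQuery-resolvent safe = All.map⁺ (All-replaceAt i safe-θ
      (All.map⁻ (over (subst (AtomOver _) unif (All.lookup safe-θ (∈-lookup i))))))
    where
    safe-θ : All (AtomOver (Covered (replaceAt Q i B [ θ ]q)) ∘ _[ θ ]ᵃ) Q
    safe-θ = All.map (AtomOver-subst θ Covered-resolvent) safe

SafeQuery-fragment : ∀ {Q₀ Q} → SafeQuery Q₀ → Fragment Q₀ Q → SafeQuery Q
SafeQuery-fragment safe start = safe
SafeQuery-fragment safe (D ▷ record
  -- Matching on `refl` exposes the input clause as a program clause instantiated by `σ`.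
  { selected = i ; rule∈P = c∈P ; variant = (σ , refl) , _ ; mgu = θ ; isMGU = unif , _ }) =
  SafeQuery-resolvent i θ (instance-preserving σ θ c∈P) unif (SafeQuery-fragment safe D)

module _ {K : Term → Set} (ρ : PropVar → Var) where

  ClauseOver-repr : ∀ c → (∀ {x} → x ∈ vars (reprClause ρ c) → K (var x)) →
                    ClauseOver K (reprClause ρ c)
  ClauseOver-repr []          f = []
  ClauseOver-repr (pos x ∷ c) f =
    -- `there` skips the variable of the literal; `∈-++⁺ˡ` accounts for the empty list ending
    -- `varsVec`.
    lit (f (here refl)) ∷ ClauseOver-repr c (f ∘ there ∘ ∈-++⁺ˡ)
  ClauseOver-repr (neg x ∷ c) f =
    lit (f (here refl)) ∷ ClauseOver-repr c (f ∘ there ∘ ∈-++⁺ˡ)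

  CNFOver-repr : ∀ φ → (∀ {x} → x ∈ vars (reprCNF ρ φ) → K (var x)) →
                 CNFOver K (reprCNF ρ φ)
  CNFOver-repr []      f = []
  CNFOver-repr (c ∷ φ) f =
    ClauseOver-repr c (f ∘ ∈-++⁺ˡ) ∷
    CNFOver-repr φ (f ∘ ∈-++⁺ʳ (vars (reprClause ρ c)) ∘ ∈-++⁺ˡ)

∈⇒∈ᵗ-listTerm : ∀ {x xs} → x ∈ xs → var x ∈ᵗ listTerm (map var xs)
∈⇒∈ᵗ-listTerm (here refl) = here
∈⇒∈ᵗ-listTerm (there m)   = there (∈⇒∈ᵗ-listTerm m)

SafeQuery-initial : ∀ φ u l → Represents u φ → ListOfVarsOf l u →
                    SafeQuery (sat⟨ u , l ⟩ ∷ [])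
SafeQuery-initial φ _ _ (ρ , _ , refl) (xs , refl , iff) =
  -- The single atom covers its own formula: each variable of `u` occurs in `l`.
  sat (CNFOver-repr ρ φ λ {x} m →
    listed (here (sat (∈⇒∈ᵗ-listTerm (Equivalence.from (iff x) m))))) ∷ []

delayed? : ∀ A → Dec (DelayedAtom A)
delayed? sat⟨ _ , _ ⟩                             = no λ ()
delayed? sat-cnf⟨ _ ⟩                             = no λ ()
delayed? sat-cl⟨ _ ⟩                              = no λ ()
delayed? sat-cl3⟨ _ , _ , _ ⟩                     = no λ ()
delayed? sat-cl5⟨ var _ , _ , var _ , _ , _ ⟩     = yes delayed
delayed? sat-cl5⟨ var _ , _ , fn _ _ , _ , _ ⟩    = no λ ()
delayed? sat-cl5⟨ fn _ _ , _ , _ , _ , _ ⟩        = no λ ()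
delayed? sat-cl5a⟨ _ , _ , _ , _ , _ ⟩            = no λ ()
delayed? (_ ≐ _)                                  = no λ ()
delayed? tflist⟨ _ ⟩                              = no λ ()
delayed? tf⟨ _ ⟩                                  = no λ ()

lists⇒¬delayed : ∀ {v A} → Lists v A → ¬ DelayedAtom A
lists⇒¬delayed (sat _)    ()
lists⇒¬delayed (tflist _) ()
lists⇒¬delayed tf         ()

safe⇒any-¬delayed : ∀ {Q} → SafeQuery Q → Q ≢ [] → Any (¬_ ∘ DelayedAtom) Q
safe⇒any-¬delayed {[]}    _       Q≢[] = contradiction refl Q≢[]
safe⇒any-¬delayed {A ∷ _} (a ∷ _) _ with delayed? A
... | no ¬d = here ¬d
... | yes delayed with a
-- The first argument is a variable, so it can only be covered by being listed.
...   | sat-cl5 (listed k) _ _ = Any.map lists⇒¬delayed k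

mainTheorem4 : (ℛ : PartialSelectionRule) →
    NeverSelects ℛ DelayedAtom →
    SelectsIfAnyNot ℛ DelayedAtom →
    (φ : CNF) (u l : Term) → Represents u φ → ListOfVarsOf l u →
    (𝒟 : Derivation (sat⟨ u , l ⟩ ∷ [])) →
    Via ℛ 𝒟 → ¬ Flounders ℛ 𝒟
mainTheorem4 ℛ _ selects φ u l repr lvars _ _ (_ , E , _ , Q≢[] , ℛE≡nothing)
  with selects E (safe⇒any-¬delayed
         (SafeQuery-fragment (SafeQuery-initial φ u l repr lvars) E) Q≢[])
... | _ , ℛE≡just with () ← trans (sym ℛE≡just) ℛE≡nothing
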